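{- The limit points of $\lambda_{2,n}(3)$ are exactly $11$ and $13$; that is, $\{v:\lambda_{2,n}(3)=v\text{ for infinitely many odd } n>1\}=\{11,13\}$.
   Context: For an odd integer $n>1$, a representation of a positive integer $k$ (with respect to $2$ and $n$) is an expression $k=\sum_{j\ge 0}\varepsilon_j(2)2^j+\sum_{j\ge 0}\varepsilon_j(n)n^j$ with only finitely many nonzero coefficients, where $\varepsilon_j(2)\in\{0,\pm1\}$ and $\varepsilon_j(n)\in\{0,\pm1,\dots,\pm\lfloor n/2\rfloor\}$ are integers. Its length is $\sum_{j\ge 0}(|\varepsilon_j(2)|+|\varepsilon_j(n)|)$. For a positive integer $h$, $\lambda_{2,n}(h)$ denotes the smallest positive integer that has a representation of length $h$ but no representation of length less than $h$. For fixed $h$, a limit point of $\lambda_{2,n}(h)$ is a value that $\lambda_{2,n}(h)$ takes for infinitely many $n$ as $n$ runs over the odd integers greater than $1$. -}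

module Defs where

import Algebra.Properties.CommutativeMonoid.Sum
open import Data.Fin using (toℕ)
open import Data.Integer as ℤ using (ℤ; +_; ∣_∣; 0ℤ)
import Data.Integer.Properties as ℤₚ
open import Data.Nat using (ℕ; _+_; _^_; _≤_; _<_; _>_; ⌊_/2⌋)
open import Data.Nat.Divisibility using (_∣_)
import Data.Nat.Properties as ℕₚ
open import Data.Product using (∃-syntax; _×_)
open import Relation.Binary.PropositionalEquality using (_≡_)
open import Relation.Nullary using (¬_)

open Algebra.Properties.CommutativeMonoid.Sum ℤₚ.+-0-commutativeMonoid
  using () renaming (sum to sumℤ)
open Algebra.Properties.CommutativeMonoid.Sum ℕₚ.+-0-commutativeMonoid
  using () renaming (sum to sumℕ)

-- For g = 2 the digit bound ⌊ g /2⌋ is 1, so the digits are 0 and ±1.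
record Expansion (g : ℕ) : Set where
  field
    ε       : ℕ → ℤ
    digit   : ∀ j → ∣ ε j ∣ ≤ ⌊ g /2⌋
    bound   : ℕ
    support : ∀ j → bound ≤ j → ε j ≡ 0ℤ

  -- Terms with index ≥ bound vanish, so neither sum depends on the bound.
  value : ℤ
  value = sumℤ {bound} (λ i → ε (toℕ i) ℤ.* + (g ^ toℕ i))

  weight : ℕ
  weight = sumℕ {bound} (λ i → ∣ ε (toℕ i) ∣)

record Representation (n k : ℕ) : Set where
  field
    base-2 : Expansion 2
    base-n : Expansion n
    sums   : + k ≡ Expansion.value base-2 ℤ.+ Expansion.value base-n

  length : ℕ
  length = Expansion.weight base-2 + Expansion.weight base-n

HasRepresentationOfLength : (n k h : ℕ) → Set
HasRepresentationOfLength n k h =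
  ∃[ r ] Representation.length {n} {k} r ≡ h

HasShortestLength : (n h k : ℕ) → Set
HasShortestLength n h k =
  HasRepresentationOfLength n k h ×
  (∀ l → l < h → ¬ HasRepresentationOfLength n k l)

-- IsLambda n h v is the graph λ_{2,n}(h) = v; stating it as a relation avoids
-- presupposing that a number of shortest length h exists.
IsLambda : (n h v : ℕ) → Set
IsLambda n h v =
  (v > 0 × HasShortestLength n h v) ×
  (∀ k → k > 0 → HasShortestLength n h k → v ≤ k)

-- Witness-producing, unlike Inf of Data.Nat.InfinitelyOften, which is ¬ finite.
InfinitelyMany : (ℕ → Set) → Set
InfinitelyMany P = ∀ N → ∃[ n ] (n > N × P n)

IsLimitPoint : (h v : ℕ) → Set
IsLimitPoint h v =
  InfinitelyMany (λ n → n > 1 × ¬ (2 ∣ n) × IsLambda n h v)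

{-# OPTIONS --safe #-}

-- For k = 11 or 13, congruences modulo 63 show that k is not a sum of at most
-- two terms ±2^a, and also not of terms ±2^a, ±n^b when n ≡ 0 (for 11) or
-- n ≡ 27 (for 13).  Hence λ = 11 whenever 63 ∣ n, and λ = 13 for
-- n = 2^(4+6N) + 11, where 11 = n - 2^(4+6N) is short.
--
-- For the converse, 11 and 13 cannot both be short when n > 45 is odd.
-- Otherwise 11 = ±2^a + X and 13 = ±2^c + Y with X = ±n^b, Y = ±n^d and
-- b, d ≥ 1, and the size of n forces a, c ≥ 6, so that X ≡ 11 and Y ≡ 13 modulo
-- 64.  Since 13 ≡ -11³ modulo 64 and n must have order 16 there, this fixes the
-- signs and d ≡ 3b modulo 16, and therefore Y ≡ -X³ modulo 255 = 3 · 5 · 17.  But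
-- (13 ∓ 2^c) + (11 ∓ 2^a)³ is never divisible by 255.
module Submission where

import Algebra.Properties.CommutativeMonoid.Sum
open import Data.Fin as Fin using (Fin; toℕ)
open import Data.Integer as ℤ using (ℤ; +_; ∣_∣; 0ℤ; 1ℤ; -1ℤ)
import Data.Integer.Divisibility.Signed as ℤ∣
open import Data.Integer.Properties as ℤₚ using (pos-+; pos-*)
open import Data.Integer.Tactic.RingSolver using (solve-∀)
open import Data.List using (List; []; _∷_; length)
open import Data.List.Relation.Unary.All as All using (All; []; _∷_)
open import Data.List.Relation.Unary.Any as Any using (Any; here; there)
open import Data.Nat
open import Data.Nat.Divisibility using (_∣_)
import Data.Nat.Divisibility as ∣
open import Data.Nat.DivMod using (_%_; _/_; m≡m%n+[m/n]*n; m%n<n; [m+kn]%n≡m%n)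
open import Data.Nat.Properties
open import Data.Product using (∃-syntax; _×_; _,_)
open import Data.Sign as Sign using (Sign; opposite)
import Data.Sign.Properties as Signₚ
open import Data.Sum using (_⊎_; inj₁; inj₂)
open import Function using (_∘_)
open import Function.Bundles using (_⇔_; mk⇔)
open import Relation.Binary.PropositionalEquality
open import Relation.Nullary using (¬_; Dec; yes; no; contradiction)
open import Relation.Nullary.Decidable
  using (True; toWitness; from-yes; map′; ¬?; _×-dec_; _→-dec_)
open import Defs

open Algebra.Properties.CommutativeMonoid.Sum ℤₚ.+-0-commutativeMonoid
  using () renaming (sum to sumℤ)
open Algebra.Properties.CommutativeMonoid.Sum +-0-commutativeMonoid
  using () renaming (sum to sumℕ)

-- Congruences

infix 4 _≋_[_] _≋?_[_]

-- A record instead of a synonym for the divisibility, so that unification recovers `x`, `y` and `m`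
-- from the type.
record _≋_[_] (x y : ℤ) (m : ℕ) : Set where
  constructor congruent
  field difference : + m ℤ∣.∣ x ℤ.- y

_≋?_[_] : ∀ x y m → Dec (x ≋ y [ m ])
x ≋? y [ m ] = map′ congruent _≋_[_].difference (+ m ℤ∣.∣? x ℤ.- y)

module _ {m : ℕ} where

  ≋-reflexive : ∀ {x y} → x ≡ y → x ≋ y [ m ]
  ≋-reflexive {x} refl = congruent (ℤ∣.divides 0ℤ (ℤₚ.+-inverseʳ x))

  ≋-refl : ∀ {x} → x ≋ x [ m ]
  ≋-refl = ≋-reflexive refl

  ≋-trans : ∀ {x y z} → x ≋ y [ m ] → y ≋ z [ m ] → x ≋ z [ m ]
  ≋-trans {x} {y} {z} (congruent p) (congruent q) =
    congruent (subst (+ m ℤ∣.∣_) (identity x y z) (ℤ∣.∣m∣n⇒∣m+n p q))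
    where
    identity : ∀ x y z → (x ℤ.- y) ℤ.+ (y ℤ.- z) ≡ x ℤ.- z
    identity = solve-∀

  ≋-neg : ∀ {x y} → x ≋ y [ m ] → (ℤ.- x) ≋ (ℤ.- y) [ m ]
  ≋-neg {x} {y} (congruent p) =
    congruent (subst (+ m ℤ∣.∣_) (ℤₚ.neg-distrib-+ x (ℤ.- y)) (ℤ∣.∣m⇒∣-m p))

  ≋-sym : ∀ {x y} → x ≋ y [ m ] → y ≋ x [ m ]
  ≋-sym {x} {y} (congruent p) =
    congruent (subst (+ m ℤ∣.∣_) (identity x y) (ℤ∣.∣m⇒∣-m p))
    where
    identity : ∀ x y → ℤ.- (x ℤ.- y) ≡ y ℤ.- x
    identity = solve-∀

  ≋-+ : ∀ {x y u v} → x ≋ y [ m ] → u ≋ v [ m ] → (x ℤ.+ u) ≋ (y ℤ.+ v) [ m ]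
  ≋-+ {x} {y} {u} {v} (congruent p) (congruent q) =
    congruent (subst (+ m ℤ∣.∣_) (identity x y u v) (ℤ∣.∣m∣n⇒∣m+n p q))
    where
    identity : ∀ x y u v → (x ℤ.- y) ℤ.+ (u ℤ.- v) ≡ (x ℤ.+ u) ℤ.- (y ℤ.+ v)
    identity = solve-∀

  ≋-* : ∀ {x y u v} → x ≋ y [ m ] → u ≋ v [ m ] → (x ℤ.* u) ≋ (y ℤ.* v) [ m ]
  ≋-* {x} {y} {u} {v} (congruent p) (congruent q) =
    congruent (subst (+ m ℤ∣.∣_) (identity x y u v)
      (ℤ∣.∣m∣n⇒∣m+n (ℤ∣.∣m⇒∣m*n u p) (ℤ∣.∣n⇒∣m*n y q)))
    where
    identity : ∀ x y u v →
      (x ℤ.- y) ℤ.* u ℤ.+ y ℤ.* (u ℤ.- v) ≡ x ℤ.* u ℤ.- y ℤ.* v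
    identity = solve-∀

  ≋-- : ∀ {x y u v} → x ≋ y [ m ] → u ≋ v [ m ] → (x ℤ.- u) ≋ (y ℤ.- v) [ m ]
  ≋-- p q = ≋-+ p (≋-neg q)

  ≋-^ : ∀ {x y} → x ≋ y [ m ] → ∀ k → (x ℤ.^ k) ≋ (y ℤ.^ k) [ m ]
  ≋-^ p zero    = ≋-refl
  ≋-^ p (suc k) = ≋-* p (≋-^ p k)

pos-^ : ∀ g k → + (g ^ k) ≡ (+ g) ℤ.^ k
pos-^ g zero    = refl
pos-^ g (suc k) = trans (pos-* g (g ^ k)) (cong (+ g ℤ.*_) (pos-^ g k))

≋-pos-^ : ∀ {m g h} → (+ g) ≋ (+ h) [ m ] → ∀ k → (+ (g ^ k)) ≋ (+ (h ^ k)) [ m ]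
≋-pos-^ {m} {g} {h} p k =
  subst₂ (_≋_[ m ]) (sym (pos-^ g k)) (sym (pos-^ h k)) (≋-^ p k)

≋-% : ∀ n m .{{_ : NonZero m}} → (+ n) ≋ (+ (n % m)) [ m ]
≋-% n m = congruent (ℤ∣.divides (+ (n / m)) (begin
  + n ℤ.- + (n % m)                                ≡⟨ cong (λ t → + t ℤ.- + (n % m)) (m≡m%n+[m/n]*n n m) ⟩
  + (n % m + n / m * m) ℤ.- + (n % m)              ≡⟨ cong (ℤ._- + (n % m)) (pos-+ (n % m) (n / m * m)) ⟩
  (+ (n % m) ℤ.+ + (n / m * m)) ℤ.- + (n % m)      ≡⟨ identity (+ (n % m)) (+ (n / m * m)) ⟩
  + (n / m * m)                                    ≡⟨ pos-* (n / m) m ⟩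
  + (n / m) ℤ.* + m                                ∎))
  where
  open ≡-Reasoning
  identity : ∀ x y → (x ℤ.+ y) ℤ.- x ≡ y
  identity = solve-∀

-- The offset `c` is a preperiod: `g` may share factors with `m`, as `n` may with 255 or 27 does
-- with 63, and then powers repeat only from some exponent on.
^-periodic : ∀ {m} g c p .{{_ : NonZero p}} →
  (+ (g ^ (c + p))) ≋ (+ (g ^ c)) [ m ] →
  ∀ k → (+ (g ^ (c + k))) ≋ (+ (g ^ (c + k % p))) [ m ]
^-periodic {m} g c p eq k =
  subst (λ t → (+ (g ^ (c + t))) ≋ (+ (g ^ (c + k % p))) [ m ])
    (sym (m≡m%n+[m/n]*n k p)) (iterate (k / p))
  where
  split : ∀ a b → + (g ^ (a + b)) ≡ + (g ^ a) ℤ.* + (g ^ b)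
  split a b = trans (cong +_ (^-distribˡ-+-* g a b)) (pos-* (g ^ a) (g ^ b))

  shift : ∀ j → (+ (g ^ ((c + p) + j))) ≋ (+ (g ^ (c + j))) [ m ]
  shift j = subst₂ (_≋_[ m ]) (sym (split (c + p) j)) (sym (split c j)) (≋-* eq ≋-refl)

  iterate : ∀ q → (+ (g ^ (c + (k % p + q * p)))) ≋ (+ (g ^ (c + k % p))) [ m ]
  iterate zero    = ≋-reflexive (cong (λ t → + (g ^ (c + t))) (+-identityʳ (k % p)))
  iterate (suc q) = ≋-trans
    (subst (λ t → (+ (g ^ t)) ≋ (+ (g ^ (c + (k % p + q * p)))) [ m ])
      rearrange (shift (k % p + q * p)))
    (iterate q)
    where
    open ≡-Reasoning
    rearrange : (c + p) + (k % p + q * p) ≡ c + (k % p + (p + q * p))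
    rearrange = begin
      (c + p) + (k % p + q * p)   ≡⟨ +-assoc c p _ ⟩
      c + (p + (k % p + q * p))   ≡⟨ cong (λ t → c + t) (+-assoc p (k % p) (q * p)) ⟨
      c + ((p + k % p) + q * p)   ≡⟨ cong (λ t → c + (t + q * p)) (+-comm p (k % p)) ⟩
      c + ((k % p + p) + q * p)   ≡⟨ cong (λ t → c + t) (+-assoc (k % p) p (q * p)) ⟩
      c + (k % p + (p + q * p))   ∎

-- Signed integers

infixr 8 _·_

_·_ : Sign → ℤ → ℤ
Sign.+ · x = x
Sign.- · x = ℤ.- x

≋-· : ∀ {m} s {x y} → x ≋ y [ m ] → (s · x) ≋ (s · y) [ m ]
≋-· Sign.+ = λ p → p
≋-· Sign.- = ≋-neg

all-signs? : ∀ {P : Sign → Set} → (∀ s → Dec (P s)) → Dec (∀ s → P s)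
all-signs? {P} P? = map′ join (λ p → p Sign.+ , p Sign.-) (P? Sign.+ ×-dec P? Sign.-)
  where
  join : P Sign.+ × P Sign.- → ∀ s → P s
  join (p , q) Sign.+ = p
  join (p , q) Sign.- = q

∣·∣ : ∀ s x → ∣ s · x ∣ ≡ ∣ x ∣
∣·∣ Sign.+ x = refl
∣·∣ Sign.- x = ℤₚ.∣-i∣≡∣i∣ x

-- The relation between the powers of n

-- 255 = 3 · 5 · 17 is squarefree and 16 is a multiple of 2, 4 and 16, so this is Fermat's little
-- theorem at each prime factor, including those that divide `n`.
n^17≋n[255] : ∀ n → (+ (n ^ 17)) ≋ (+ (n ^ 1)) [ 255 ]
n^17≋n[255] n = ≋-trans (≋-pos-^ (≋-% n 255) 17)
  (≋-trans (check (m%n<n n 255)) (≋-sym (≋-pos-^ (≋-% n 255) 1)))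
  where
  check : ∀ {ν} → ν < 255 → (+ (ν ^ 17)) ≋ (+ (ν ^ 1)) [ 255 ]
  check = from-yes (allUpTo? (λ ν → (+ (ν ^ 17)) ≋? (+ (ν ^ 1)) [ 255 ]) 255)

-- The unit group modulo 64 has exponent 16, so the powers of an odd `n` have the same period 16 as
-- modulo 255.
n^17≋n[64] : ∀ {n} → ¬ 2 ∣ n → (+ (n ^ 17)) ≋ (+ (n ^ 1)) [ 64 ]
n^17≋n[64] {n} odd = ≋-trans (≋-pos-^ (≋-% n 64) 17)
  (≋-trans (check (m%n<n n 64) (odd ∘ ∣.∣n∣m%n⇒∣m (∣.divides 32 refl)))
    (≋-sym (≋-pos-^ (≋-% n 64) 1)))
  where
  check : ∀ {ν} → ν < 64 → ¬ 2 ∣ ν → (+ (ν ^ 17)) ≋ (+ (ν ^ 1)) [ 64 ]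
  check = from-yes (allUpTo?
    (λ ν → ¬? (2 ∣.∣? ν) →-dec (+ (ν ^ 17)) ≋? (+ (ν ^ 1)) [ 64 ]) 64)

-- The exponent 3 (b + 1) is kept in successor form because the powers of `n` modulo 255 are
-- periodic only from exponent 1 on.
cube-·-suc-^ : ∀ s n b →
  (s · + (n ^ suc b)) ℤ.^ 3 ≡ s · + (n ^ suc (2 + 3 * b))
cube-·-suc-^ s n b = trans (cube s (+ (n ^ suc b))) (cong (s ·_) (begin
  (+ (n ^ suc b)) ℤ.^ 3   ≡⟨ pos-^ (n ^ suc b) 3 ⟨
  + ((n ^ suc b) ^ 3)     ≡⟨ cong +_ (^-*-assoc n (suc b) 3) ⟩
  + (n ^ (suc b * 3))     ≡⟨ cong (λ k → + (n ^ (3 + k))) (*-comm b 3) ⟩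
  + (n ^ suc (2 + 3 * b)) ∎))
  where
  open ≡-Reasoning
  cube : ∀ s x → (s · x) ℤ.^ 3 ≡ s · (x ℤ.^ 3)
  cube Sign.+ x = refl
  cube Sign.- x = identity x
    where
    identity : ∀ x →
      (ℤ.- x) ℤ.* ((ℤ.- x) ℤ.* ((ℤ.- x) ℤ.* 1ℤ)) ≡ ℤ.- (x ℤ.* (x ℤ.* (x ℤ.* 1ℤ)))
    identity = solve-∀

-- The conclusion on exponents says δ + 1 ≡ 3 (β + 1) modulo 16.
Exponents : Sign → Sign → Set
Exponents s t = ∀ {ν} → ν < 64 → ∀ {β} → β < 16 →
  (s · + (ν ^ suc β)) ≋ (+ 11) [ 64 ] → ∀ {δ} → δ < 16 →
  (t · + (ν ^ suc δ)) ≋ (+ 13) [ 64 ] →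
  t ≡ opposite s × (2 + 3 * β) % 16 ≡ δ

-- The first congruence makes ±11, of order 16, a power of ν, so ν has order 16 and ν^8 ≡ 33. Thus
-- -1 is not a power of ν, and 13 ≡ -11³ determines both the sign and the exponent modulo 16.
exponents : ∀ s t → Exponents s t
exponents = from-yes (all-signs? λ s → all-signs? λ t → exponents? s t)
  where
  exponents? : ∀ s t → Dec (Exponents s t)
  -- The quantifier over δ stands behind the first congruence, so δ is searched only for the pairs
  -- (ν, β) that satisfy it.
  exponents? s t = allUpTo? (λ ν → allUpTo? (λ β →
    ((s · + (ν ^ suc β)) ≋? (+ 11) [ 64 ]) →-dec allUpTo? (λ δ →
    ((t · + (ν ^ suc δ)) ≋? (+ 13) [ 64 ]) →-dec
    ((t Signₚ.≟ opposite s) ×-dec ((2 + 3 * β) % 16 ≟ δ))) 16) 16) 64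

-- Since 16 is a period for both moduli, the relation between exponents found modulo 64 carries over
-- to modulo 255, where the opposite signs make the two powers of `n` cancel.
cube-relation : ∀ {n} → ¬ 2 ∣ n → ∀ s t b d →
  (s · + (n ^ suc b)) ≋ (+ 11) [ 64 ] →
  (t · + (n ^ suc d)) ≋ (+ 13) [ 64 ] →
  ((t · + (n ^ suc d)) ℤ.+ (s · + (n ^ suc b)) ℤ.^ 3) ≋ 0ℤ [ 255 ]
cube-relation {n} odd s t b d p q =
  let t≡ , δ≡ = exponents s t (m%n<n n 64) (m%n<n b 16)
                  (≋-trans (≋-sym (reduce64 s b)) p) (m%n<n d 16)
                  (≋-trans (≋-sym (reduce64 t d)) q)
  in ≋-trans (≋-+ (≋-· t (reduce d))
                  (≋-trans (≋-reflexive (cube-·-suc-^ s n b)) (≋-· s (b-side δ≡))))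
             (≋-reflexive (trans (cong (λ u → u · _ ℤ.+ s · _) t≡)
                                 (cancel s (+ (n ^ suc (d % 16))))))
  where
  reduce64 : ∀ s k → (s · + (n ^ suc k)) ≋ (s · + ((n % 64) ^ suc (k % 16))) [ 64 ]
  reduce64 s k = ≋-· s (≋-trans (^-periodic n 1 16 (n^17≋n[64] odd) k)
                                (≋-pos-^ (≋-% n 64) (suc (k % 16))))

  reduce : ∀ k → (+ (n ^ suc k)) ≋ (+ (n ^ suc (k % 16))) [ 255 ]
  reduce = ^-periodic n 1 16 (n^17≋n[255] n)

  3b%16 : (2 + 3 * b) % 16 ≡ (2 + 3 * (b % 16)) % 16
  3b%16 = trans (cong (_% 16) (begin
    2 + 3 * b                                ≡⟨ cong (λ k → 2 + 3 * k) (m≡m%n+[m/n]*n b 16) ⟩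
    2 + 3 * (b % 16 + b / 16 * 16)           ≡⟨ cong (λ k → 2 + k) (*-distribˡ-+ 3 (b % 16) _) ⟩
    2 + (3 * (b % 16) + 3 * (b / 16 * 16))   ≡⟨ +-assoc 2 (3 * (b % 16)) _ ⟨
    2 + 3 * (b % 16) + 3 * (b / 16 * 16)     ≡⟨ cong (λ k → 2 + 3 * (b % 16) + k) (*-assoc 3 (b / 16) 16) ⟨
    2 + 3 * (b % 16) + 3 * (b / 16) * 16     ∎))
    ([m+kn]%n≡m%n (2 + 3 * (b % 16)) (3 * (b / 16)) 16)
    where open ≡-Reasoning

  b-side : (2 + 3 * (b % 16)) % 16 ≡ d % 16 →
    (+ (n ^ suc (2 + 3 * b))) ≋ (+ (n ^ suc (d % 16))) [ 255 ]
  b-side δ≡ = subst (λ k → (+ (n ^ suc (2 + 3 * b))) ≋ (+ (n ^ suc k)) [ 255 ])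
    (trans 3b%16 δ≡) (reduce (2 + 3 * b))

  cancel : ∀ s x → opposite s · x ℤ.+ s · x ≡ 0ℤ
  cancel Sign.+ x = ℤₚ.+-inverseˡ x
  cancel Sign.- x = ℤₚ.+-inverseʳ x

2^a≋2^[a%8][255] : ∀ a → (+ (2 ^ a)) ≋ (+ (2 ^ (a % 8))) [ 255 ]
2^a≋2^[a%8][255] = ^-periodic 2 0 8 (from-yes ((+ 256) ≋? (+ 1) [ 255 ]))

-- Powers of 2 have period 8 modulo 255, which leaves 256 cases: two signs and two exponents below
-- 8.
no-cube-relation : ∀ s t a c →
  ¬ (((+ 13 ℤ.- t · + (2 ^ c)) ℤ.+ (+ 11 ℤ.- s · + (2 ^ a)) ℤ.^ 3) ≋ 0ℤ [ 255 ])
no-cube-relation s t a c p = check s t (m%n<n a 8) (m%n<n c 8)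
  (≋-trans (≋-sym (≋-+ (≋-- (≋-refl {x = + 13}) (≋-· t (2^a≋2^[a%8][255] c)))
                   (≋-^ (≋-- (≋-refl {x = + 11}) (≋-· s (2^a≋2^[a%8][255] a))) 3))) p)
  where
  Check : Sign → Sign → Set
  Check s t = ∀ {α} → α < 8 → ∀ {γ} → γ < 8 →
    ¬ (((+ 13 ℤ.- t · + (2 ^ γ)) ℤ.+ (+ 11 ℤ.- s · + (2 ^ α)) ℤ.^ 3) ≋ 0ℤ [ 255 ])

  check? : ∀ s t → Dec (Check s t)
  check? s t = allUpTo? (λ α → allUpTo? (λ γ → ¬? (_ ≋? _ [ 255 ])) 8) 8

  check : ∀ s t → Check s t
  check = from-yes (all-signs? λ s → all-signs? λ t → check? s t)

-- Residues modulo 63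

-- Powers of `n` start at exponent 1 because n^0 = 2^0 counts as a power of 2. The case `none` pads
-- sums of fewer than two terms.
data Summand (n : ℕ) : ℤ → Set where
  none   : Summand n 0ℤ
  pow-2  : ∀ s a → Summand n (s · + (2 ^ a))
  pow-n  : ∀ s b → Summand n (s · + (n ^ suc b))

TwoTerm : ℕ → ℤ → Set
TwoTerm n k = ∃[ x ] ∃[ y ] (Summand n x × Summand n y × k ≡ x ℤ.+ y)

Residue : List ℤ → ℤ → Set
Residue R x = Any (λ r → x ≋ r [ 63 ]) R

Separated : List ℤ → ℤ → Set
Separated R k = All (λ r → All (λ r′ → ¬ (k ≋ (r ℤ.+ r′) [ 63 ])) R) R

Separated? : ∀ R k → Dec (Separated R k)
Separated? R k = All.all? (λ r → All.all? (λ r′ → ¬? (k ≋? (r ℤ.+ r′) [ 63 ])) R) R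

separated : ∀ {R k x y} → Separated R k → Residue R x → Residue R y → k ≢ x ℤ.+ y
separated sep x∈ y∈ refl =
  let row , x≋r = All.lookupAny sep x∈
      k≢ , y≋r′ = All.lookupAny row y∈
  in k≢ (≋-+ x≋r y≋r′)

-- As 2^6 ≡ 1 modulo 63, these 13 residues cover every ±2^a as well as the absent term 0.
powersOf2 : List ℤ
powersOf2 = 0ℤ ∷ + 1 ∷ + 2 ∷ + 4 ∷ + 8 ∷ + 16 ∷ + 32
  ∷ ℤ.- + 1 ∷ ℤ.- + 2 ∷ ℤ.- + 4 ∷ ℤ.- + 8 ∷ ℤ.- + 16 ∷ ℤ.- + 32 ∷ []

Residue-resp : ∀ {R x y} → x ≋ y [ 63 ] → Residue R y → Residue R x
Residue-resp p = Any.map (≋-trans p)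

0-residue : Residue powersOf2 0ℤ
0-residue = here ≋-refl

±2^a-residue : ∀ s a → Residue powersOf2 (s · + (2 ^ a))
±2^a-residue s a = Residue-resp
  (≋-· s (^-periodic 2 0 6 (from-yes ((+ 64) ≋? (+ 1) [ 63 ])) a))
  (check s (m%n<n a 6))
  where
  check? : ∀ s → Dec (∀ {α} → α < 6 → Residue powersOf2 (s · + (2 ^ α)))
  check? s = allUpTo? (λ α → Any.any? (λ r → (s · + (2 ^ α)) ≋? r [ 63 ]) powersOf2) 6

  check : ∀ s → ∀ {α} → α < 6 → Residue powersOf2 (s · + (2 ^ α))
  check = from-yes (all-signs? check?)

-- This serves twice: if 63 divides `n`, powers of `n` only contribute the listed residue 0; for
-- arbitrary `n`, it rules out sums of two powers of 2.
11-separated : Separated powersOf2 (+ 11)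
11-separated = from-yes (Separated? powersOf2 (+ 11))

-- 27² ≡ -27 modulo 63, so for n ≡ 27 all positive powers of `n`, with either sign, fall on ±27.
residues27 : List ℤ
residues27 = + 27 ∷ ℤ.- + 27 ∷ powersOf2

13-separated : Separated residues27 (+ 13)
13-separated = from-yes (Separated? residues27 (+ 13))

summand-residue-0 : ∀ {n} → (+ n) ≋ 0ℤ [ 63 ] →
  ∀ {x} → Summand n x → Residue powersOf2 x
summand-residue-0 n≋0 none        = 0-residue
summand-residue-0 n≋0 (pow-2 s a) = ±2^a-residue s a
summand-residue-0 {n} n≋0 (pow-n s b) = here (≋-trans
  (≋-· s (≋-trans (≋-reflexive (pos-* n (n ^ b))) (≋-* n≋0 (≋-refl {x = + (n ^ b)}))))
  (≋-reflexive (s·0 s)))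
  where
  s·0 : ∀ s → s · 0ℤ ≡ 0ℤ
  s·0 Sign.+ = refl
  s·0 Sign.- = refl

summand-residue-27 : ∀ {n} → (+ n) ≋ (+ 27) [ 63 ] →
  ∀ {x} → Summand n x → Residue residues27 x
summand-residue-27 n≋27 none        = there (there 0-residue)
summand-residue-27 n≋27 (pow-2 s a) = there (there (±2^a-residue s a))
summand-residue-27 {n} n≋27 (pow-n s b) = Residue-resp
  (≋-· s (≋-trans (≋-pos-^ n≋27 (suc b))
     (^-periodic 27 1 2 (from-yes ((+ (27 ^ 3)) ≋? (+ 27) [ 63 ])) b)))
  (check s (m%n<n b 2))
  where
  check? : ∀ s → Dec (∀ {β} → β < 2 → Residue residues27 (s · + (27 ^ suc β)))
  check? s = allUpTo? (λ β → Any.any? (λ r → (s · + (27 ^ suc β)) ≋? r [ 63 ]) residues27) 2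

  check : ∀ s → ∀ {β} → β < 2 → Residue residues27 (s · + (27 ^ suc β))
  check = from-yes (all-signs? check?)

-- From representations to summands

-- The index counts terms with multiplicity: a digit e becomes |e| equal signed powers, so the index
-- matches the length of a representation.
data SumOf (P : ℤ → Set) : ℕ → ℤ → Set where
  []  : SumOf P 0 0ℤ
  _∷_ : ∀ {l x y} → P x → SumOf P l y → SumOf P (suc l) (x ℤ.+ y)

module _ {P : ℤ → Set} where

  _++ˢ_ : ∀ {k l x y} → SumOf P k x → SumOf P l y → SumOf P (k + l) (x ℤ.+ y)
  _++ˢ_ {y = y} [] q = subst (SumOf P _) (sym (ℤₚ.+-identityˡ y)) q
  _++ˢ_ {y = y} (_∷_ {x = x} {y = z} p ps) q =
    subst (SumOf P _) (sym (ℤₚ.+-assoc x z y)) (p ∷ (ps ++ˢ q))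

  multiple : ∀ {x} → (∀ s → P (s · x)) → ∀ e → SumOf P ∣ e ∣ (e ℤ.* x)
  multiple {x} px (+ zero)  = subst (SumOf P 0) (sym (ℤₚ.*-zeroˡ x)) []
  multiple {x} px (+ suc k) = subst (SumOf P (suc k)) (sym (ℤₚ.suc-* (+ k) x))
    (px Sign.+ ∷ multiple px (+ k))
  multiple {x} px ℤ.-[1+ zero ]  = subst (SumOf P 1) (identity x) (px Sign.- ∷ [])
    where
    identity : ∀ x → ℤ.- x ℤ.+ 0ℤ ≡ ℤ.- 1ℤ ℤ.* x
    identity = solve-∀
  multiple {x} px ℤ.-[1+ suc k ] = subst (SumOf P (suc (suc k)))
    (sym (identity ℤ.-[1+ k ] x)) (px Sign.- ∷ multiple px ℤ.-[1+ k ])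
    where
    identity : ∀ e x → (ℤ.- 1ℤ ℤ.+ e) ℤ.* x ≡ ℤ.- x ℤ.+ e ℤ.* x
    identity = solve-∀

  sum-SumOf : ∀ {m} {l : Fin m → ℕ} {x : Fin m → ℤ} →
    (∀ i → SumOf P (l i) (x i)) → SumOf P (sumℕ l) (sumℤ x)
  sum-SumOf {zero}  ps = []
  sum-SumOf {suc m} ps = ps Fin.zero ++ˢ sum-SumOf (ps ∘ Fin.suc)

expansion-SumOf : ∀ {g P} → (∀ s j → P (s · + (g ^ j))) → (E : Expansion g) →
  SumOf P (Expansion.weight E) (Expansion.value E)
expansion-SumOf pow E =
  sum-SumOf {m = bound} (λ i → multiple (λ s → pow s (toℕ i)) (ε (toℕ i)))
  where open Expansion E

summand-n : ∀ {n} s j → Summand n (s · + (n ^ j))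
summand-n s zero    = pow-2 s 0
summand-n s (suc b) = pow-n s b

representation-SumOf : ∀ {n k} (r : Representation n k) →
  SumOf (Summand n) (Representation.length r) (+ k)
representation-SumOf r = subst (SumOf _ _) (sym sums)
  (expansion-SumOf pow-2 base-2 ++ˢ expansion-SumOf summand-n base-n)
  where open Representation r

HasShorter : (n k h : ℕ) → Set
HasShorter n k h = ∃[ l ] (l < h × HasRepresentationOfLength n k l)

short⇒twoTerm : ∀ {n k} → HasShorter n k 3 → TwoTerm n (+ k)
short⇒twoTerm {n} {k} (l , l<3 , r , refl) = go l<3 (representation-SumOf r)
  where
  go : ∀ {l x} → l < 3 → SumOf (Summand n) l x → TwoTerm n x
  go _ []           = 0ℤ , 0ℤ , none , none , refl
  go _ (p ∷ [])     = _ , 0ℤ , p , none , refl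
  go _ (_∷_ {x = x} p (_∷_ {x = y} q [])) = x , y , p , q , cong (λ t → x ℤ.+ t) (ℤₚ.+-identityʳ y)
  go (s≤s (s≤s (s≤s ()))) (_ ∷ (_ ∷ (_ ∷ _)))

-- Explicit representations

digit : List ℤ → ℕ → ℤ
digit []       j       = 0ℤ
digit (e ∷ es) zero    = e
digit (e ∷ es) (suc j) = digit es j

digits : ∀ g es → All (λ e → ∣ e ∣ ≤ ⌊ g /2⌋) es → Expansion g
digits g es ok = record
  { ε       = digit es
  ; digit   = digit≤ es ok
  ; bound   = length es
  ; support = support es
  }
  where
  digit≤ : ∀ es → All (λ e → ∣ e ∣ ≤ ⌊ g /2⌋) es → ∀ j → ∣ digit es j ∣ ≤ ⌊ g /2⌋
  digit≤ []       []       j       = z≤n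
  digit≤ (e ∷ es) (p ∷ ps) zero    = p
  digit≤ (e ∷ es) (p ∷ ps) (suc j) = digit≤ es ps j

  support : ∀ es j → length es ≤ j → digit es j ≡ 0ℤ
  support []       j       _         = refl
  support (e ∷ es) (suc j) (s≤s p) = support es j p

binary : (es : List ℤ) → {True (All.all? (λ e → ∣ e ∣ ≤? 1) es)} → Expansion 2
binary es {ok} = digits 2 es (toWitness ok)

binary-representation : ∀ n k es {ok} → + k ≡ Expansion.value (binary es {ok}) ℤ.+ 0ℤ →
  HasRepresentationOfLength n k (Expansion.weight (binary es {ok}) + 0)
binary-representation n k es {ok} eq =
  record { base-2 = binary es {ok} ; base-n = digits n [] [] ; sums = eq } , refl

-- At most two signed powers of 2 suffice, which is why `n` is arbitrary.
short-below-13 : ∀ n k → k > 0 → k < 13 → k ≢ 11 → HasShorter n k 3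
short-below-13 n 0 () _ _
short-below-13 n 1  _ _ _ = 1 , s≤s (s≤s z≤n) , binary-representation n 1  (1ℤ ∷ []) refl
short-below-13 n 2  _ _ _ = 1 , s≤s (s≤s z≤n) , binary-representation n 2  (0ℤ ∷ 1ℤ ∷ []) refl
short-below-13 n 3  _ _ _ = 2 , ≤-refl , binary-representation n 3  (1ℤ ∷ 1ℤ ∷ []) refl
short-below-13 n 4  _ _ _ = 1 , s≤s (s≤s z≤n) , binary-representation n 4  (0ℤ ∷ 0ℤ ∷ 1ℤ ∷ []) refl
short-below-13 n 5  _ _ _ = 2 , ≤-refl , binary-representation n 5  (1ℤ ∷ 0ℤ ∷ 1ℤ ∷ []) refl
short-below-13 n 6  _ _ _ = 2 , ≤-refl , binary-representation n 6  (0ℤ ∷ 1ℤ ∷ 1ℤ ∷ []) refl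
short-below-13 n 7  _ _ _ = 2 , ≤-refl , binary-representation n 7  (-1ℤ ∷ 0ℤ ∷ 0ℤ ∷ 1ℤ ∷ []) refl
short-below-13 n 8  _ _ _ = 1 , s≤s (s≤s z≤n) , binary-representation n 8  (0ℤ ∷ 0ℤ ∷ 0ℤ ∷ 1ℤ ∷ []) refl
short-below-13 n 9  _ _ _ = 2 , ≤-refl , binary-representation n 9  (1ℤ ∷ 0ℤ ∷ 0ℤ ∷ 1ℤ ∷ []) refl
short-below-13 n 10 _ _ _ = 2 , ≤-refl , binary-representation n 10 (0ℤ ∷ 1ℤ ∷ 0ℤ ∷ 1ℤ ∷ []) refl
short-below-13 n 11 _ _ k≢11 = contradiction refl k≢11
short-below-13 n 12 _ _ _ = 2 , ≤-refl , binary-representation n 12 (0ℤ ∷ 0ℤ ∷ 1ℤ ∷ 1ℤ ∷ []) refl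
short-below-13 n (suc (suc (suc (suc (suc (suc (suc (suc (suc (suc (suc (suc (suc k))))))))))))) _ k<13 _ =
  contradiction k<13 (m+n≮m 13 k)

11-representation : ∀ n → HasRepresentationOfLength n 11 3
11-representation n = binary-representation n 11 (1ℤ ∷ 1ℤ ∷ 0ℤ ∷ 1ℤ ∷ []) refl

13-representation : ∀ n → HasRepresentationOfLength n 13 3
13-representation n = binary-representation n 13 (1ℤ ∷ 0ℤ ∷ 1ℤ ∷ 1ℤ ∷ []) refl

monomial : ℕ → ℤ → List ℤ
monomial zero    e = e ∷ []
monomial (suc i) e = 0ℤ ∷ monomial i e

monomial-All : ∀ {P : ℤ → Set} i {e} → P 0ℤ → P e → All P (monomial i e)
monomial-All zero    p0 pe = pe ∷ []
monomial-All (suc i) p0 pe = p0 ∷ monomial-All i p0 pe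

-- An arbitrary sequence `x` replaces the powers of the base because the induction passes to
-- `x ∘ suc`.
monomial-value : ∀ i e (x : ℕ → ℤ) →
  sumℤ {length (monomial i e)} (λ j → digit (monomial i e) (toℕ j) ℤ.* x (toℕ j)) ≡ e ℤ.* x i
monomial-value zero    e x = ℤₚ.+-identityʳ _
monomial-value (suc i) e x = trans
  (cong₂ ℤ._+_ (ℤₚ.*-zeroˡ (x 0)) (monomial-value i e (x ∘ suc)))
  (ℤₚ.+-identityˡ (e ℤ.* x (suc i)))

monomial-weight : ∀ i e →
  sumℕ {length (monomial i e)} (λ j → ∣ digit (monomial i e) (toℕ j) ∣) ≡ ∣ e ∣
monomial-weight zero    e = +-identityʳ _
monomial-weight (suc i) e = monomial-weight i e

n-2^a-representation : ∀ n a k → 2 ≤ n → n ≡ 2 ^ a + k →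
  HasRepresentationOfLength n k 2
n-2^a-representation n a k 2≤n n≡ = record
  { base-2 = digits 2 (monomial a -1ℤ) (monomial-All a z≤n (s≤s z≤n))
  -- The digit 1 is admissible since n ≥ 2 gives ⌊n/2⌋ ≥ 1.
  ; base-n = digits n (monomial 1 1ℤ) (monomial-All 1 z≤n (⌊n/2⌋-mono 2≤n))
  ; sums   = begin
      + k
        ≡⟨ identity (+ (2 ^ a)) (+ k) ⟩
      -1ℤ ℤ.* + (2 ^ a) ℤ.+ 1ℤ ℤ.* (+ (2 ^ a) ℤ.+ + k)
        ≡⟨ cong (λ t → -1ℤ ℤ.* + (2 ^ a) ℤ.+ 1ℤ ℤ.* t) (pos-+ (2 ^ a) k) ⟨
      -1ℤ ℤ.* + (2 ^ a) ℤ.+ 1ℤ ℤ.* + (2 ^ a + k)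
        ≡⟨ cong (λ t → -1ℤ ℤ.* + (2 ^ a) ℤ.+ 1ℤ ℤ.* + t) (trans (*-identityʳ n) n≡) ⟨
      -1ℤ ℤ.* + (2 ^ a) ℤ.+ 1ℤ ℤ.* + (n ^ 1)
        ≡⟨ cong₂ ℤ._+_ (monomial-value a -1ℤ (λ j → + (2 ^ j)))
                       (monomial-value 1 1ℤ (λ j → + (n ^ j))) ⟨
      _ ∎
  } , cong₂ _+_ (monomial-weight a -1ℤ) (monomial-weight 1 1ℤ)
  where
  open ≡-Reasoning
  identity : ∀ x y → y ≡ ℤ.- 1ℤ ℤ.* x ℤ.+ 1ℤ ℤ.* (x ℤ.+ y)
  identity = solve-∀

-- Limit points

no-twoTerm : ∀ {n k R} → Separated R k →
  (∀ {x} → Summand n x → Residue R x) → ¬ TwoTerm n k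
no-twoTerm sep residue (x , y , p , q , k≡) =
  separated sep (residue p) (residue q) k≡

hasShortestLength : ∀ {n k h} → HasRepresentationOfLength n k h →
  ¬ HasShorter n k h → HasShortestLength n h k
hasShortestLength rep ¬shorter = rep , λ l l<h r → ¬shorter (l , l<h , r)

isLambda-11 : ∀ {n} → (+ n) ≋ 0ℤ [ 63 ] → IsLambda n 3 11
isLambda-11 {n} n≋0 =
  ( s≤s z≤n
  , hasShortestLength (11-representation n)
      (no-twoTerm 11-separated (summand-residue-0 n≋0) ∘ short⇒twoTerm) )
  , λ k k>0 (_ , shortest) → ≮⇒≥ (λ k<11 →
      let l , l<3 , r = short-below-13 n k k>0
                          (<-≤-trans k<11 (from-yes (11 ≤? 13))) (<⇒≢ k<11)
      in shortest l l<3 r)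

-- The short representation of 11 removes the only exception below 13, while the residue 27 keeps 13
-- itself from being short.
isLambda-13 : ∀ {n} → (+ n) ≋ (+ 27) [ 63 ] →
  HasRepresentationOfLength n 11 2 → IsLambda n 3 13
isLambda-13 {n} n≋27 rep11 =
  ( s≤s z≤n
  , hasShortestLength (13-representation n)
      (no-twoTerm 13-separated (summand-residue-27 n≋27) ∘ short⇒twoTerm) )
  , λ k k>0 (_ , shortest) → ≮⇒≥ (λ k<13 →
      let l , l<3 , r = short k k>0 k<13
      in shortest l l<3 r)
  where
  short : ∀ k → k > 0 → k < 13 → HasShorter n k 3
  short k k>0 k<13 with k ≟ 11
  ... | yes refl = 2 , ≤-refl , rep11
  ... | no k≢11  = short-below-13 n k k>0 k<13 k≢11

n<2^n : ∀ n → n < 2 ^ n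
n<2^n zero    = s≤s z≤n
n<2^n (suc n) = ≤-trans (+-mono-≤ (m^n>0 2 n) (n<2^n n))
  (≤-reflexive (cong (λ t → 2 ^ n + t) (sym (+-identityʳ _))))

limit-11 : IsLimitPoint 3 11
limit-11 N = n , n>N , n>1 , odd , isLambda-11 n≋0
  where
  n = 63 * suc (2 * N)

  n>N : n > N
  n>N = ≤-trans (s≤s (m≤n*m N 2)) (m≤n*m (suc (2 * N)) 63)

  n>1 : n > 1
  n>1 = ≤-trans (from-yes (2 ≤? 63)) (m≤m*n 63 (suc (2 * N)))

  odd : ¬ 2 ∣ n
  odd 2∣n = from-yes (¬? (2 ∣.∣? 63)) (∣.∣m+n∣m⇒∣n
    (subst (2 ∣_) (trans (*-suc 63 (2 * N)) (+-comm 63 (63 * (2 * N)))) 2∣n)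
    (∣.∣n⇒∣m*n 63 (∣.m∣m*n N)))

  n≋0 : (+ n) ≋ 0ℤ [ 63 ]
  n≋0 = ≋-trans (≋-reflexive (pos-* 63 (suc (2 * N))))
    (≋-* (from-yes ((+ 63) ≋? 0ℤ [ 63 ])) (≋-refl {x = + suc (2 * N)}))

limit-13 : IsLimitPoint 3 13
limit-13 N = n , n>N , n>1 , odd , isLambda-13
    (≋-trans (≋-reflexive (pos-+ (2 ^ a) 11)) (≋-+ 2^a≋16 (≋-refl {x = + 11})))
    (n-2^a-representation n a 11 n>1 refl)
  where
  -- Exponents congruent to 4 modulo 6 give 2^a ≡ 16 modulo 63, hence n ≡ 27.
  a = 4 + 6 * N
  n = 2 ^ a + 11

  n>N : n > N
  n>N = <-≤-trans (n<2^n N) (≤-trans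
    (^-monoʳ-≤ 2 (≤-trans (m≤n*m N 6) (m≤n+m (6 * N) 4))) (m≤m+n (2 ^ a) 11))

  n>1 : n > 1
  n>1 = ≤-trans (from-yes (2 ≤? 11)) (m≤n+m 11 (2 ^ a))

  odd : ¬ 2 ∣ n
  odd 2∣n = from-yes (¬? (2 ∣.∣? 11)) (∣.∣m+n∣m⇒∣n 2∣n (∣.m∣m*n (2 ^ (3 + 6 * N))))

  2^a≋16 : (+ (2 ^ a)) ≋ (+ 16) [ 63 ]
  2^a≋16 = ≋-trans (^-periodic 2 4 6 (from-yes ((+ 1024) ≋? (+ 16) [ 63 ])) (6 * N))
    (≋-reflexive (cong (λ k → + (2 ^ (4 + k))) (∣.n∣m⇒m%n≡0 (6 * N) 6 (∣.m∣m*n N))))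

-- Odd n > 45

isolate : ∀ {k x y} → k ≡ x ℤ.+ y → y ≡ k ℤ.- x
isolate {x = x} {y} refl = identity x y
  where
  identity : ∀ x y → y ≡ (x ℤ.+ y) ℤ.- x
  identity = solve-∀

Mixed : ℕ → ℤ → Set
Mixed n k = ∃[ s ] ∃[ a ] ∃[ t ] ∃[ b ] k ≡ s · + (2 ^ a) ℤ.+ t · + (n ^ suc b)

∣-· : ∀ {d x} s → d ℤ∣.∣ x → d ℤ∣.∣ s · x
∣-· Sign.+ d∣x = d∣x
∣-· Sign.- d∣x = ℤ∣.∣m⇒∣-m d∣x

n∣±n^ : ∀ n s b → + n ℤ∣.∣ s · + (n ^ suc b)
n∣±n^ n s b = ∣-· s (ℤ∣.∣ᵤ⇒∣ (∣.m∣m*n (n ^ b)))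

multiples-sum-≢ : ∀ {n k} .{{_ : NonZero k}} → k < n →
  ∀ {x y} → + n ℤ∣.∣ x → + n ℤ∣.∣ y → + k ≢ x ℤ.+ y
multiples-sum-≢ k<n n∣x n∣y k≡ =
  ∣.>⇒∤ k<n (ℤ∣.∣⇒∣ᵤ (subst (_ ℤ∣.∣_) (sym k≡) (ℤ∣.∣m∣n⇒∣m+n n∣x n∣y)))

-- Without a power of `n` the sum is excluded modulo 63; without a power of 2 it is a multiple of
-- `n`, which cannot equal `k` as 0 < k < n.
mixed : ∀ {n k} .{{_ : NonZero k}} → k < n → Separated powersOf2 (+ k) →
  TwoTerm n (+ k) → Mixed n (+ k)
mixed {n} {k} k<n sep = λ where
    (_ , _ , none      , none      , k≡) → contradiction k≡ (separated sep 0-residue 0-residue)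
    (_ , _ , none      , pow-2 t b , k≡) → contradiction k≡ (separated sep 0-residue (±2^a-residue t b))
    (_ , _ , pow-2 s a , none      , k≡) → contradiction k≡ (separated sep (±2^a-residue s a) 0-residue)
    (_ , _ , pow-2 s a , pow-2 t b , k≡) → contradiction k≡ (separated sep (±2^a-residue s a) (±2^a-residue t b))
    (_ , _ , none      , pow-n t b , k≡) → contradiction k≡ (multiples n∣0 (n∣±n^ n t b))
    (_ , _ , pow-n s a , none      , k≡) → contradiction k≡ (multiples (n∣±n^ n s a) n∣0)
    (_ , _ , pow-n s a , pow-n t b , k≡) → contradiction k≡ (multiples (n∣±n^ n s a) (n∣±n^ n t b))
    (_ , _ , pow-2 s a , pow-n t b , k≡) → s , a , t , b , k≡
    (x , y , pow-n t b , pow-2 s a , k≡) → s , a , t , b , trans k≡ (ℤₚ.+-comm x y)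
  where
  n∣0 : + n ℤ∣.∣ 0ℤ
  n∣0 = ℤ∣.divides 0ℤ refl

  multiples : ∀ {x y} → + n ℤ∣.∣ x → + n ℤ∣.∣ y → + k ≢ x ℤ.+ y
  multiples = multiples-sum-≢ k<n

-- An exponent a ≤ 5 would give n ≤ |k ∓ 2^a| ≤ k + 32.
2^a≋0[64] : ∀ {n k} s a t b → k + 32 < n →
  + k ≡ s · + (2 ^ a) ℤ.+ t · + (n ^ suc b) →
  (s · + (2 ^ a)) ≋ 0ℤ [ 64 ]
2^a≋0[64] {n} {k} s a t b k+32<n k≡ with a <? 6
... | yes (s≤s a≤5) = contradiction k+32<n (≤⇒≯ (begin
  n                                ≤⟨ m≤m*n n (n ^ b) {{m^n≢0 n b {{>-nonZero (≤-<-trans z≤n k+32<n)}}}} ⟩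
  n ^ suc b                        ≡⟨ ∣·∣ t (+ (n ^ suc b)) ⟨
  ∣ t · + (n ^ suc b) ∣            ≡⟨ cong ∣_∣ (isolate {x = s · + (2 ^ a)} k≡) ⟩
  ∣ + k ℤ.- s · + (2 ^ a) ∣        ≤⟨ ℤₚ.∣i-j∣≤∣i∣+∣j∣ (+ k) (s · + (2 ^ a)) ⟩
  k + ∣ s · + (2 ^ a) ∣            ≡⟨ cong (λ u → k + u) (∣·∣ s (+ (2 ^ a))) ⟩
  k + 2 ^ a                        ≤⟨ +-monoʳ-≤ k (^-monoʳ-≤ 2 a≤5) ⟩
  k + 32                           ∎))
  where
  open ≤-Reasoning
... | no a≮6 with j , refl ← m≤n⇒∃[o]m+o≡n (≮⇒≥ a≮6) =
  congruent (subst (+ 64 ℤ∣.∣_) (sym (ℤₚ.+-identityʳ _))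
    (∣-· s (ℤ∣.∣ᵤ⇒∣ (subst (64 ∣_) (sym (^-distribˡ-+-* 2 6 j)) (∣.m∣m*n (2 ^ j))))))

power-residue : ∀ {n k} s a t b → k + 32 < n →
  + k ≡ s · + (2 ^ a) ℤ.+ t · + (n ^ suc b) →
  (t · + (n ^ suc b)) ≋ (+ k) [ 64 ]
power-residue {k = k} s a t b k+32<n k≡ =
  ≋-trans (≋-reflexive (isolate {x = s · + (2 ^ a)} k≡))
  (≋-trans (≋-- (≋-refl {x = + k}) (2^a≋0[64] s a t b k+32<n k≡))
           (≋-reflexive (ℤₚ.+-identityʳ (+ k))))

-- The threshold is 45 = 13 + 32, where 32 = 2^5 is the largest power of 2 not divisible by 64; for
-- 11 the corresponding bound is 43.
not-both-mixed : ∀ {n} → 45 < n → ¬ 2 ∣ n → Mixed n (+ 11) → ¬ Mixed n (+ 13)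
not-both-mixed {n} 45<n odd (s , a , t , b , 11≡) (s′ , c , t′ , d , 13≡) =
  no-cube-relation s s′ a c (subst₂ (λ x y → (y ℤ.+ x ℤ.^ 3) ≋ 0ℤ [ 255 ])
    (isolate {x = s · + (2 ^ a)} 11≡) (isolate {x = s′ · + (2 ^ c)} 13≡)
    (cube-relation odd t t′ b d
      (power-residue s a t b (≤-trans (from-yes (44 ≤? 46)) 45<n) 11≡)
      (power-residue s′ c t′ d 45<n 13≡)))

not-both-short : ∀ {n} → 45 < n → ¬ 2 ∣ n → HasShorter n 11 3 → ¬ HasShorter n 13 3
not-both-short 45<n odd short11 short13 = not-both-mixed 45<n odd
  (mixed (≤-trans (from-yes (12 ≤? 46)) 45<n) 11-separated (short⇒twoTerm short11))
  (mixed (≤-trans (from-yes (14 ≤? 46)) 45<n) 13-separated-2 (short⇒twoTerm short13))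
  where
  -- No residue of `n` modulo 63 is known here, so only powers of 2 are listed.
  13-separated-2 : Separated powersOf2 (+ 13)
  13-separated-2 = from-yes (Separated? powersOf2 (+ 13))

-- Below 13 only 11 can fail to be short. If v > 13, minimality of `v` would force both 11 and 13 to
-- be short, which is impossible.
isLambda⇒11⊎13 : ∀ {n v} → 45 < n → ¬ 2 ∣ n → IsLambda n 3 v → v ≡ 11 ⊎ v ≡ 13
isLambda⇒11⊎13 {n} {v} 45<n odd ((v>0 , _ , shortest) , least) with v ≟ 11
... | yes v≡11 = inj₁ v≡11
... | no  v≢11 = inj₂ (≤-antisym (≮⇒≥ 13≮v) (≮⇒≥ v≮13))
  where
  v≮13 : ¬ v < 13
  v≮13 v<13 = let l , l<3 , r = short-below-13 n v v>0 v<13 v≢11 in shortest l l<3 r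

  13≮v : ¬ 13 < v
  13≮v 13<v =
    <⇒≱ (<-trans (from-yes (11 <? 13)) 13<v) (least 11 (s≤s z≤n)
      (hasShortestLength (11-representation n) λ short11 →
        <⇒≱ 13<v (least 13 (s≤s z≤n)
          (hasShortestLength (13-representation n) (not-both-short 45<n odd short11)))))

corollary2 : ∀ (v : ℕ) → IsLimitPoint 3 v ⇔ (v ≡ 11 ⊎ v ≡ 13)
corollary2 v = mk⇔ to from
  where
  to : IsLimitPoint 3 v → v ≡ 11 ⊎ v ≡ 13
  -- A single odd n > 45 with this value already decides `v`.
  to limit = let n , 45<n , _ , odd , λ≡v = limit 45 in isLambda⇒11⊎13 45<n odd λ≡v

  from : v ≡ 11 ⊎ v ≡ 13 → IsLimitPoint 3 v
  from (inj₁ refl) = limit-11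
  from (inj₂ refl) = limit-13
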